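{- Let $G \ne K_4$ be a connected, claw-free, cubic graph, and let $u(G)$ denote the number of units of $G$. Then \[ u(G)+1 \le \sigma_{(2,1)}(G) \le u(G)+2 . \]
   Context: A graph is claw-free if it has no induced subgraph isomorphic to $K_{1,3}$; it is cubic if every vertex has degree $3$. A diamond is an induced subgraph isomorphic to $K_4$ minus one edge. For a connected, claw-free, cubic graph $G\neq K_4$, the vertex set $V(G)$ can be uniquely partitioned into sets each of which induces a triangle or a diamond in $G$; the parts of this partition are called units (triangle-units and diamond-units), and $u(G)$ is the number of units. $(p,q)$-spreading: let $p\in\mathbb{N}$ and $q\in\mathbb{N}\cup\{\infty\}$. Start with a set $S\subseteq V(G)$ of blue vertices, all other vertices white. The color change rule: if a white vertex $w$ has at least $p$ blue neighbors, and at least one of the blue neighbors of $w$ has at most $q$ white neighbors, then $w$ is recolored blue. $S$ is a $(p,q)$-spreading set if repeatedly applying this rule eventually colors all vertices blue. $\sigma_{(p,q)}(G)$ is the minimum cardinality of a $(p,q)$-spreading set of $G$. -}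

module Defs where

open import Data.Empty using (⊥-elim)
open import Data.Fin.Base using (Fin; zero; suc)
open import Data.Fin.Patterns using (0F; 1F; 2F; 3F)
open import Data.Fin.Properties using (_≟_; any?; all?; injective⇒≤)
open import Data.Fin.Subset using (Subset; inside; outside; ⊤; ⁅_⁆; ∁; _∩_; _∪_; _-_; _∈_; _∉_; _⊆_; ∣_∣; Nonempty)
open import Data.Fin.Subset.Properties
open import Data.List.Base as List using (List; deduplicate; allFin)
open import Data.List.Membership.Propositional.Properties using (∈-map⁺; ∈-map⁻; ∈-allFin; ∈-lookup; ∈-deduplicate⁺; ∈-deduplicate⁻)
open import Data.List.Relation.Unary.All as All using ()
open import Data.List.Relation.Unary.AllPairs using (_∷_)
open import Data.List.Relation.Unary.Any as Any using ()
open import Data.List.Relation.Unary.Any.Properties using (lookup-index)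
open import Data.List.Relation.Unary.Unique.Propositional using (Unique)
import Data.List.Relation.Unary.Unique.DecPropositional.Properties as UniqueDec
open import Data.Nat.Base using (ℕ; suc; _∸_; _≤_; _<_; z≤n; s≤s)
open import Data.Nat.Induction using (<-wellFounded)
open import Data.Nat.Properties using (≤-trans; ≤-antisym; n≮n; ≮⇒≥; _<?_; _≤?_; ∸-monoʳ-<; suc-injective)
open import Data.Product using (Σ; ∃; ∃!; ∃-syntax; _×_; _,_; proj₁; proj₂)
open import Data.Sum using (_⊎_; inj₁; inj₂; [_,_]′)
open import Data.Vec.Base as Vec using (Vec; []; _∷_; tabulate; lookup; here; there)
open import Data.Vec.Properties as Vecₚ using (lookup∘tabulate; lookup⇒[]=; []=⇒lookup)
open import Data.Bool.Properties as Boolₚ using ()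
open import Function.Base using (_∘_; case_of_)
open import Function.Bundles using (_⇔_; mk⇔; Equivalence)
open import Function.Definitions using (Injective; StrictlySurjective)
open import Induction.WellFounded using (Acc; acc)
open import Relation.Binary.Construct.Closure.ReflexiveTransitive using (Star; ε; _◅_)
open import Relation.Binary.PropositionalEquality using (_≡_; _≢_; refl; sym; trans; cong; subst; ≢-sym)
open import Relation.Nullary using (¬_; Dec; yes; no; does)
open import Relation.Nullary.Construct.Add.Supremum using (_⁺; [_])
open import Relation.Nullary.Decidable using (_×-dec_; _⊎-dec_; ¬?; from-yes; dec-true; map′)
import Relation.Binary.Construct.Add.Supremum.NonStrict _≤_ as Sup

open Equivalence using (to; from)

private variable
  m n : ℕ

record Graph (n : ℕ) : Set where
  field
    nbhd   : Fin n → Subset n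
    irrefl : ∀ v → v ∉ nbhd v
    symm   : ∀ {v w} → w ∈ nbhd v → v ∈ nbhd w

  infix 4 _~_
  _~_ : Fin n → Fin n → Set
  v ~ w = w ∈ nbhd v

  infix 4 _~?_
  _~?_ : ∀ v w → Dec (v ~ w)
  v ~? w = w ∈? nbhd v

open Graph using (nbhd)

record _↪_ (H : Graph m) (G : Graph n) : Set where
  field
    map       : Fin m → Fin n
    injective : Injective _≡_ _≡_ map
    adjacency : ∀ i j → Graph._~_ H i j ⇔ Graph._~_ G (map i) (map j)

open _↪_ using (map)

_≅_ : Graph m → Graph n → Set
H ≅ G = Σ (H ↪ G) λ f → StrictlySurjective _≡_ (map f)

Induces : Graph n → Subset n → Graph m → Set
Induces G U H = Σ (H ↪ G) λ f → ∀ v → v ∈ U ⇔ (∃[ i ] map f i ≡ v)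

K : ∀ m → Graph m
K m = record
  { nbhd   = λ v → ∁ ⁅ v ⁆
  ; irrefl = λ v v∈ → x∈∁p⇒x∉p v∈ (x∈⁅x⁆ v)
  ; symm   = λ {v} {w} w∈ → x∉p⇒x∈∁p λ v∈ →
      x∈∁p⇒x∉p w∈ (subst (_∈ ⁅ v ⁆) (x∈⁅y⁆⇒x≡y w v∈) (x∈⁅x⁆ v))
  }

K₁,₃ : Graph 4
K₁,₃ = record
  { nbhd   = N
  ; irrefl = from-yes (all? λ v → ¬? (v ∈? N v))
  ; symm   = λ {v} {w} → sy v w
  }
  where
  N : Fin 4 → Subset 4
  N 0F      = outside ∷ inside ∷ inside ∷ inside ∷ []
  N (suc _) = ⁅ 0F ⁆

  sy : ∀ v w → w ∈ N v → v ∈ N w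
  sy 0F      0F      ()
  sy 0F      (suc w) _    = here
  sy (suc v) 0F      here = from-yes (all? λ w → suc w ∈? N 0F) v
  sy (suc v) (suc w) p    with () ← x∈⁅y⁆⇒x≡y 0F p

-- K₄ minus the edge {0, 1}.
K₄-e : Graph 4
K₄-e = record
  { nbhd   = N
  ; irrefl = from-yes (all? λ v → ¬? (v ∈? N v))
  ; symm   = λ {v} {w} p → [ (λ w∉ → ⊥-elim (w∉ p)) , (λ v∈ → v∈) ]′
      (from-yes (all? λ v → all? λ w → ¬? (w ∈? N v) ⊎-dec (v ∈? N w)) v w)
  }
  where
  N : Fin 4 → Subset 4
  N 0F = outside ∷ outside ∷ inside  ∷ inside  ∷ []
  N 1F = outside ∷ outside ∷ inside  ∷ inside  ∷ []
  N 2F = inside  ∷ inside  ∷ outside ∷ inside  ∷ []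
  N 3F = inside  ∷ inside  ∷ inside  ∷ outside ∷ []

-- The null graph does not count as connected.
Connected : Graph n → Set
Connected {n} G = Fin n × (∀ v w → Star (Graph._~_ G) v w)

ClawFree : Graph n → Set
ClawFree G = ¬ (K₁,₃ ↪ G)

Cubic : Graph n → Set
Cubic G = ∀ v → ∣ nbhd G v ∣ ≡ 3

IsUnit : Graph n → Subset n → Set
IsUnit G U = Induces G U (K 3) ⊎ Induces G U K₄-e

record UnitPartition (G : Graph n) : Set where
  field
    size      : ℕ
    part      : Fin size → Subset n
    isUnit    : ∀ i → IsUnit G (part i)
    partition : ∀ v → ∃! _≡_ λ i → v ∈ part i

-- ℕ ⁺ is ℕ ∪ {∞}, with ⊤⁺ as ∞.

module _ (p : ℕ) (q : ℕ ⁺) (G : Graph n) where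

  record CanRecolor (S : Subset n) (w : Fin n) : Set where
    constructor canRecolor
    field
      white     : w ∉ S
      blueNbrs  : p ≤ ∣ nbhd G w ∩ S ∣
      forcer    : ∃[ b ] b ∈ nbhd G w ∩ S × [ ∣ nbhd G b ∩ ∁ S ∣ ] Sup.≤⁺ q

  data Recolors (S : Subset n) : Subset n → Set where
    recolor : ∀ {w} → CanRecolor S w → Recolors S (S ∪ ⁅ w ⁆)

  IsSpreadingSet : Subset n → Set
  IsSpreadingSet S = Star Recolors S ⊤

  private
    canRecolor? : ∀ S w → Dec (CanRecolor S w)
    canRecolor? S w = map′ (λ (a , b , c) → canRecolor a b c)
      (λ (canRecolor a b c) → a , b , c)
      (¬? (w ∈? S) ×-dec (p ≤? _) ×-dec
        any? λ b → (b ∈? _) ×-dec Sup.≤⁺-dec _≤?_ _ q)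

    ∩-monoʳ : ∀ {A B C : Subset n} → B ⊆ C → A ∩ B ⊆ A ∩ C
    ∩-monoʳ {A} {B} B⊆C x∈ with a , b ← x∈p∩q⁻ A B x∈ = x∈p∩q⁺ (a , B⊆C b)

    canRecolor-mono : ∀ {S T w} → S ⊆ T → w ∉ T → CanRecolor S w → CanRecolor T w
    canRecolor-mono {S} {T} {w} S⊆T w∉T (canRecolor _ blue (b , b∈ , few)) = canRecolor w∉T
      (≤-trans blue (p⊆q⇒∣p∣≤∣q∣ (∩-monoʳ {nbhd G w} S⊆T)))
      (b , ∩-monoʳ {nbhd G w} S⊆T b∈ , Sup.≤⁺-trans ≤-trans
        Sup.[ p⊆q⇒∣p∣≤∣q∣ (∩-monoʳ {nbhd G b} (p⊆q⇒∁p⊇∁q S⊆T)) ] few)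

    S∪w⊆ : ∀ {S T : Subset n} {w} → S ⊆ T → w ∈ T → S ∪ ⁅ w ⁆ ⊆ T
    S∪w⊆ {S} {T} {w} S⊆T w∈T x∈ with x∈p∪q⁻ S ⁅ w ⁆ x∈
    ... | inj₁ x∈S = S⊆T x∈S
    ... | inj₂ x∈w = subst (_∈ T) (sym (x∈⁅y⁆⇒x≡y w x∈w)) w∈T

  -- Hence a recoloring never blocks another, and their order is irrelevant.
  spreading-mono : ∀ {S T} → S ⊆ T → IsSpreadingSet S → IsSpreadingSet T
  spreading-mono {S} {T} S⊆T ε = subst (λ X → Star Recolors X ⊤) (⊆-antisym S⊆T ⊆⊤) ε
  spreading-mono {S} {T} S⊆T (recolor {w} r ◅ rs) with w ∈? T
  ... | yes w∈T = spreading-mono (S∪w⊆ S⊆T w∈T) rs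
  ... | no  w∉T = recolor (canRecolor-mono S⊆T w∉T r) ◅
    spreading-mono (S∪w⊆ (p⊆p∪q _ ∘ S⊆T) (q⊆p∪q T _ (x∈⁅x⁆ w))) rs

  isSpreadingSet? : ∀ S → Dec (IsSpreadingSet S)
  isSpreadingSet? S = go S (<-wellFounded _)
    where
    stuck : ∀ {S} → ¬ (∃[ w ] CanRecolor S w) → S ≢ ⊤ → ¬ IsSpreadingSet S
    stuck _ S≢⊤ ε = S≢⊤ refl
    stuck none _ (recolor r ◅ _) = none (_ , r)

    go : ∀ S → Acc _<_ (n ∸ ∣ S ∣) → Dec (IsSpreadingSet S)
    go S (acc rec) with any? (canRecolor? S)
    ... | yes (w , r) = map′ (recolor r ◅_) (spreading-mono (p⊆p∪q _))
      (go (S ∪ ⁅ w ⁆) (rec (∸-monoʳ-<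
        (p⊂q⇒∣p∣<∣q∣ (p⊆p∪q ⁅ w ⁆ , w , q⊆p∪q S _ (x∈⁅x⁆ w) , CanRecolor.white r))
        (∣p∣≤n (S ∪ ⁅ w ⁆)))))
    ... | no none with Vecₚ.≡-dec Boolₚ._≟_ S ⊤
    ...   | yes refl = yes ε
    ...   | no  S≢⊤  = no (stuck none S≢⊤)

  minimumSpreadingSet : ∃[ S ] IsSpreadingSet S × (∀ T → IsSpreadingSet T → ∣ S ∣ ≤ ∣ T ∣)
  minimumSpreadingSet = go ⊤ ε (<-wellFounded _)
    where
    go : ∀ S → IsSpreadingSet S → Acc _<_ ∣ S ∣ →
         ∃[ S ] IsSpreadingSet S × (∀ T → IsSpreadingSet T → ∣ S ∣ ≤ ∣ T ∣)
    go S sp (acc rec) with anySubset? (λ T → isSpreadingSet? T ×-dec (∣ T ∣ <? ∣ S ∣))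
    ... | yes (T , spT , T<S) = go T spT (rec T<S)
    ... | no  none            = S , sp , λ T spT → ≮⇒≥ λ T<S → none (T , spT , T<S)

σ : ℕ → ℕ ⁺ → Graph n → ℕ
σ p q G = ∣ proj₁ (minimumSpreadingSet p q G) ∣

private

  4≤∣p∣ : ∀ {S : Subset n} {a b c d} → a ∈ S → b ∈ S → c ∈ S → d ∈ S →
          a ≢ b → a ≢ c → a ≢ d → b ≢ c → b ≢ d → c ≢ d → 4 ≤ ∣ S ∣
  4≤∣p∣ {S = S} {a} {b} {c} {d} a∈ b∈ c∈ d∈ ab ac ad bc bd cd =
    ≤-trans (s≤s (≤-trans (s≤s (≤-trans (s≤s (≤-trans (s≤s z≤n)
      (x∈p⇒∣p-x∣<∣p∣ d₃))) (x∈p⇒∣p-x∣<∣p∣ c₂))) (x∈p⇒∣p-x∣<∣p∣ b₁))) (x∈p⇒∣p-x∣<∣p∣ a∈)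
    where
    b₁ : b ∈ S - a
    b₁ = x∈p∧x≢y⇒x∈p-y b∈ (≢-sym ab)
    c₂ : c ∈ S - a - b
    c₂ = x∈p∧x≢y⇒x∈p-y (x∈p∧x≢y⇒x∈p-y c∈ (≢-sym ac)) (≢-sym bc)
    d₃ : d ∈ S - a - b - c
    d₃ = x∈p∧x≢y⇒x∈p-y (x∈p∧x≢y⇒x∈p-y (x∈p∧x≢y⇒x∈p-y d∈ (≢-sym ad)) (≢-sym bd)) (≢-sym cd)

  extract : ∀ {k} (S : Subset n) → ∣ S ∣ ≡ suc k →
            ∃[ x ] ∃[ T ] x ∈ S × x ∉ T × T ⊆ S × ∣ T ∣ ≡ k
  extract (inside  ∷ S) eq = zero , outside ∷ S , here , (λ ()) , (λ { (there q) → there q }) , suc-injective eq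
  extract (outside ∷ S) eq with x , T , x∈ , x∉ , T⊆ , e ← extract S eq =
    suc x , outside ∷ T , there x∈ , (λ { (there q) → x∉ q }) , (λ { (there q) → there (T⊆ q) }) , e

  three : (S : Subset n) → ∣ S ∣ ≡ 3 →
          ∃[ a ] ∃[ b ] ∃[ c ] (a ∈ S × b ∈ S × c ∈ S) × (a ≢ b × a ≢ c × b ≢ c)
  three S eq
    with a , T , a∈ , a∉ , T⊆ , eq₁ ← extract S eq
    with b , R , b∈ , b∉ , R⊆ , eq₂ ← extract T eq₁
    with c , _ , c∈ , _ ← extract R eq₂
    = a , b , c , (a∈ , T⊆ b∈ , T⊆ (R⊆ c∈))
    , (λ { refl → a∉ b∈ }) , (λ { refl → a∉ (R⊆ c∈) }) , (λ { refl → b∉ c∈ })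

  image : (Fin m → Fin n) → Subset n
  image f = tabulate λ v → does (any? λ i → f i ≟ v)

  ∈-image : ∀ (f : Fin m → Fin n) v → v ∈ image f ⇔ (∃[ i ] f i ≡ v)
  ∈-image f v = mk⇔
    (λ v∈ → witness (trans (sym (lookup∘tabulate _ v)) ([]=⇒lookup v∈)))
    (λ p → lookup⇒[]= v _ (trans (lookup∘tabulate _ v) (dec-true (any? _) p)))
    where
    witness : does (any? λ i → f i ≟ v) ≡ inside → ∃[ i ] f i ≡ v
    witness eq with any? (λ i → f i ≟ v)
    ... | yes p = p
    witness () | no _

  lookup-injective : ∀ {xs : List (Subset n)} → Unique xs → ∀ {i j} → List.lookup xs i ≡ List.lookup xs j → i ≡ j
  lookup-injective (x∉ ∷ u) {zero}  {zero}  eq = refl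
  lookup-injective (x∉ ∷ u) {zero}  {suc j} eq = ⊥-elim (All.lookup x∉ (∈-lookup j) eq)
  lookup-injective (x∉ ∷ u) {suc i} {zero}  eq = ⊥-elim (All.lookup x∉ (∈-lookup i) (sym eq))
  lookup-injective (x∉ ∷ u) {suc i} {suc j} eq = cong suc (lookup-injective u eq)

  fromCover : (G : Graph n) (U : Fin n → Subset n) → (∀ v → v ∈ U v) → (∀ v → IsUnit G (U v)) →
              (∀ v w {x} → x ∈ U v → x ∈ U w → U v ≡ U w) → UnitPartition G
  fromCover {n} G U v∈Uv unit disjoint = record
    { size      = List.length units
    ; part      = List.lookup units
    ; isUnit    = λ i → case origin i of λ (v , eq) → subst (IsUnit G) (sym eq) (unit v)
    ; partition = λ v →
        let v∈units = ∈-deduplicate⁺ _≟ₛ_ (∈-map⁺ U (∈-allFin v))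
            eq      = lookup-index v∈units
        in Any.index v∈units , subst (v ∈_) eq (v∈Uv v) , λ {j} v∈j →
          case origin j of λ (w , eqⱼ) →
            lookup-injective (UniqueDec.deduplicate-! _≟ₛ_ all)
              (trans (sym eq) (trans (disjoint v w (v∈Uv v) (subst (v ∈_) eqⱼ v∈j)) (sym eqⱼ)))
    }
    where
    _≟ₛ_ : (S T : Subset n) → Dec (S ≡ T)
    _≟ₛ_ = Vecₚ.≡-dec Boolₚ._≟_

    all units : List (Subset n)
    all   = List.map U (allFin n)
    units = deduplicate _≟ₛ_ all

    origin : ∀ i → ∃[ v ] List.lookup units i ≡ U v
    origin i with v , _ , eq ← ∈-map⁻ U (∈-deduplicate⁻ _≟ₛ_ all (∈-lookup {xs = units} i)) = v , eq

module _ (G : Graph n) where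
  open Graph G hiding (nbhd)

  private
    ~⇒≢ : ∀ {v w} → v ~ w → v ≢ w
    ~⇒≢ {v} p refl = irrefl v p

    Closed : Subset n → Set
    Closed U = ∀ {a b c} → a ~ b → a ~ c → b ~ c → a ∈ U → b ∈ U

    Linked : (H : Graph m) (i j : Fin m) → Set
    Linked H i j = Graph._~_ H i j × (∃[ k ] Graph._~_ H i k × Graph._~_ H j k)

    linked? : ∀ (H : Graph m) i j → Dec (Linked H i j)
    linked? H i j = Graph._~?_ H i j ×-dec any? λ k → Graph._~?_ H i k ×-dec Graph._~?_ H j k

    UnitShape : Graph m → Set
    UnitShape H =
      (∀ i j → i ≡ j ⊎ Linked H i j ⊎ (∃[ k ] Linked H i k × Linked H k j)) ×
      (∀ i → ∃[ j ] ∃[ k ] j ≢ k × Graph._~_ H i j × Graph._~_ H i k)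

    unitShape? : ∀ (H : Graph m) → Dec (UnitShape H)
    unitShape? H =
      (all? λ i → all? λ j → (i ≟ j) ⊎-dec linked? H i j ⊎-dec any? λ k → linked? H i k ×-dec linked? H k j)
      ×-dec
      (all? λ i → any? λ j → any? λ k → ¬? (j ≟ k) ×-dec Graph._~?_ H i j ×-dec Graph._~?_ H i k)

    shapeOf : ∀ {U} → IsUnit G U → ∃[ m ] Σ (Graph m) λ H → UnitShape H × Induces G U H
    shapeOf (inj₁ t) = 3 , K 3 , from-yes (unitShape? (K 3)) , t
    shapeOf (inj₂ d) = 4 , K₄-e , from-yes (unitShape? K₄-e) , d

    unit⊆closed : ∀ {U W v} → IsUnit G U → Closed W → v ∈ U → v ∈ W → U ⊆ W
    unit⊆closed {U} {W} {v} unit closed v∈U v∈W {x} x∈U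
      with m , H , (conn , _) , f , im ← shapeOf unit
      with i , refl ← to (im v) v∈U
      with j , refl ← to (im x) x∈U
      = case conn i j of λ
        { (inj₁ refl) → v∈W
        ; (inj₂ (inj₁ l)) → move l v∈W
        ; (inj₂ (inj₂ (k , l , l′))) → move l′ (move l v∈W) }
      where
      move : ∀ {i j} → Linked H i j → map f i ∈ W → map f j ∈ W
      move (ij , k , ik , jk) = closed (to (adj _ _) ij) (to (adj _ _) ik) (to (adj _ _) jk)
        where adj = _↪_.adjacency f

    twoNbrs : ∀ {U v} → IsUnit G U → v ∈ U → ∃[ x ] ∃[ y ] x ≢ y × (x ∈ U × y ∈ U) × v ~ x × v ~ y
    twoNbrs {U} {v} unit v∈U
      with m , H , (_ , two) , f , im ← shapeOf unit
      with i , refl ← to (im v) v∈U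
      with j , k , j≢k , ij , ik ← two i
      = map f j , map f k , j≢k ∘ _↪_.injective f
      , (from (im _) (j , refl) , from (im _) (k , refl))
      , to (_↪_.adjacency f _ _) ij , to (_↪_.adjacency f _ _) ik

  module _ (cubic : Cubic G) where
    private
      noFour : ∀ {v a b c d} → v ~ a → v ~ b → v ~ c → v ~ d →
               a ≢ b → a ≢ c → a ≢ d → b ≢ c → b ≢ d → ¬ (c ≢ d)
      noFour {v} va vb vc vd ab ac ad bc bd cd =
        n≮n 3 (subst (4 ≤_) (cubic v) (4≤∣p∣ va vb vc vd ab ac ad bc bd cd))

      ∈≢∉ : ∀ {U : Subset n} {x y} → x ∈ U → y ∉ U → x ≢ y
      ∈≢∉ x∈ y∉ refl = y∉ x∈

      closed⁺ : ∀ {U} → IsUnit G U →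
        (∀ {e a c} → e ∉ U → a ∈ U → c ∈ U → a ~ c → e ~ a → ¬ (e ~ c)) → Closed U
      closed⁺ {U} unit apart {a} {b} {c} ab ac bc a∈ with b ∈? U
      ... | yes b∈ = b∈
      ... | no  b∉ with c ∈? U
      ...   | yes c∈ = ⊥-elim (apart b∉ a∈ c∈ ac (symm ab) bc)
      ...   | no  c∉ with x , y , x≢y , (x∈ , y∈) , ax , ay ← twoNbrs unit a∈ =
        ⊥-elim (noFour ax ay ab ac x≢y (∈≢∉ x∈ b∉) (∈≢∉ x∈ c∉) (∈≢∉ y∈ b∉) (∈≢∉ y∈ c∉) (~⇒≢ bc))

      part-closed : (P : UnitPartition G) → ∀ i → Closed (UnitPartition.part P i)
      part-closed P i = closed⁺ (isUnit i) apart
        where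
        open UnitPartition P
        apart : ∀ {e a c} → e ∉ part i → a ∈ part i → c ∈ part i → a ~ c → e ~ a → ¬ (e ~ c)
        apart {e} e∉ a∈ c∈ ac ea ec
          with j , e∈ , _ ← partition e
          with x , y , x≢y , (x∈ , y∈) , ex , ey ← twoNbrs (isUnit j) e∈
          = noFour ea ec ex ey (~⇒≢ ac) (∈≢∉ a∈ (out x∈)) (∈≢∉ a∈ (out y∈))
              (∈≢∉ c∈ (out x∈)) (∈≢∉ c∈ (out y∈)) x≢y
          where
          out : ∀ {z} → z ∈ part j → z ∉ part i
          out {z} z∈j z∈i with k , _ , uniq ← partition z
            with refl ← uniq z∈j | refl ← uniq z∈i = e∉ e∈

    private
      nonempty : ∀ {U} → IsUnit G U → Nonempty U
      nonempty (inj₁ (f , im)) = map f 0F , from (im _) (0F , refl)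
      nonempty (inj₂ (f , im)) = map f 0F , from (im _) (0F , refl)

    part-unique : (P Q : UnitPartition G) → ∀ i → ∃[ j ] UnitPartition.part P i ≡ UnitPartition.part Q j
    part-unique P Q i
      with v , v∈ ← nonempty (UnitPartition.isUnit P i)
      with j , v∈′ , _ ← UnitPartition.partition Q v
      = j , ⊆-antisym
          (unit⊆closed (UnitPartition.isUnit P i) (part-closed Q j) v∈ v∈′)
          (unit⊆closed (UnitPartition.isUnit Q j) (part-closed P i) v∈′ v∈)

    size-unique : (P Q : UnitPartition G) → UnitPartition.size P ≡ UnitPartition.size Q
    size-unique P Q = ≤-antisym (half P Q) (half Q P)
      where
      half : (P Q : UnitPartition G) → UnitPartition.size P ≤ UnitPartition.size Q
      half P Q = injective⇒≤ {f = λ i → proj₁ (part-unique P Q i)} inj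
        where
        open UnitPartition P
        same : ∀ {i j} → part i ≡ part j → i ≡ j
        same {i} {j} eq
          with x , x∈ ← nonempty (isUnit i)
          with k , _ , uniq ← partition x
          = trans (sym (uniq x∈)) (uniq (subst (x ∈_) eq x∈))
        inj : Injective _≡_ _≡_ (λ i → proj₁ (part-unique P Q i))
        inj {i} {j} eq = same (trans (proj₂ (part-unique P Q i))
          (trans (cong (UnitPartition.part Q) eq) (sym (proj₂ (part-unique P Q j)))))

    private
      Good : ∀ (H : Graph m) (f : Fin m → Fin n) (i j : Fin m) → Set
      Good H f i j = (f i ≡ f j → i ≡ j) × (Graph._~_ H i j ⇔ f i ~ f j)

      embed : (H : Graph m) (f : Fin m → Fin n) → (∀ i j → Good H f i j) → H ↪ G
      embed H f good = record
        { map = f ; injective = proj₁ (good _ _) ; adjacency = λ i j → proj₂ (good i j) }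

      good-refl : (H : Graph m) (f : Fin m → Fin n) → ∀ i → Good H f i i
      good-refl H f i = (λ _ → refl)
        , mk⇔ (λ p → ⊥-elim (Graph.irrefl H i p)) (λ p → ⊥-elim (irrefl (f i) p))

      good-sym : (H : Graph m) (f : Fin m → Fin n) → ∀ {i j} → Good H f i j → Good H f j i
      good-sym H f (inj , e) = sym ∘ inj ∘ sym
        , mk⇔ (symm ∘ to e ∘ Graph.symm H) (Graph.symm H ∘ from e ∘ symm)

      good-edge : (H : Graph m) (f : Fin m → Fin n) → ∀ {i j} → Graph._~_ H i j → f i ~ f j → Good H f i j
      good-edge H f p q = (⊥-elim ∘ ~⇒≢ q) , mk⇔ (λ _ → q) (λ _ → p)

      good-nonedge : (H : Graph m) (f : Fin m → Fin n) → ∀ {i j} →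
        ¬ Graph._~_ H i j → f i ≢ f j → ¬ (f i ~ f j) → Good H f i j
      good-nonedge H f p ne q = (⊥-elim ∘ ne) , mk⇔ (⊥-elim ∘ p) (⊥-elim ∘ q)

      embed₃ : (H : Graph 3) (f : Fin 3 → Fin n) →
        Good H f 0F 1F → Good H f 0F 2F → Good H f 1F 2F → H ↪ G
      embed₃ H f a b c = embed H f λ
        { 0F 0F → r 0F ; 0F 1F → a   ; 0F 2F → b
        ; 1F 0F → s a  ; 1F 1F → r 1F ; 1F 2F → c
        ; 2F 0F → s b  ; 2F 1F → s c ; 2F 2F → r 2F }
        where
        r = good-refl H f
        s : ∀ {i j} → Good H f i j → Good H f j i
        s = good-sym H f

      embed₄ : (H : Graph 4) (f : Fin 4 → Fin n) →
        Good H f 0F 1F → Good H f 0F 2F → Good H f 0F 3F →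
        Good H f 1F 2F → Good H f 1F 3F → Good H f 2F 3F → H ↪ G
      embed₄ H f a b c d e g = embed H f λ
        { 0F 0F → r 0F ; 0F 1F → a   ; 0F 2F → b   ; 0F 3F → c
        ; 1F 0F → s a  ; 1F 1F → r 1F ; 1F 2F → d   ; 1F 3F → e
        ; 2F 0F → s b  ; 2F 1F → s d ; 2F 2F → r 2F ; 2F 3F → g
        ; 3F 0F → s c  ; 3F 1F → s e ; 3F 2F → s g ; 3F 3F → r 3F }
        where
        r = good-refl H f
        s : ∀ {i j} → Good H f i j → Good H f j i
        s = good-sym H f

      ClosedUnitAt : Fin n → Set
      ClosedUnitAt v = ∃[ U ] v ∈ U × IsUnit G U × Closed U

      diamond : ∀ {p q r s} → p ≢ q → ¬ (p ~ q) → p ~ r → p ~ s → q ~ r → q ~ s → r ~ s →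
                ∃[ U ] (∀ i → lookup (p ∷ q ∷ r ∷ s ∷ []) i ∈ U) × IsUnit G U × Closed U
      diamond {p} {q} {r} {s} p≢q p≁q pr ps qr qs rs =
        U , (λ i → from (im _) (i , refl)) , unit , closed⁺ unit apart
        where
        f : Fin 4 → Fin n
        f = lookup (p ∷ q ∷ r ∷ s ∷ [])

        U : Subset n
        U = image f

        im : ∀ v → v ∈ U ⇔ (∃[ i ] f i ≡ v)
        im = ∈-image f

        unit : IsUnit G U
        unit = inj₂ (embed₄ K₄-e f
          (good-nonedge K₄-e f (λ { (there ()) }) p≢q p≁q)
          (good-edge K₄-e f (there (there here)) pr)
          (good-edge K₄-e f (there (there (there here))) ps)
          (good-edge K₄-e f (there (there here)) qr)
          (good-edge K₄-e f (there (there (there here))) qs)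
          (good-edge K₄-e f (there (there (there here))) rs) , im)

        e≢ : ∀ {e} → e ∉ U → ∀ i → f i ≢ e
        e≢ e∉ i refl = e∉ (from (im _) (i , refl))

        e≁r : ∀ {e} → e ∉ U → ¬ (e ~ r)
        e≁r e∉ er = noFour (symm pr) (symm qr) rs (symm er)
          p≢q (~⇒≢ ps) (e≢ e∉ 0F) (~⇒≢ qs) (e≢ e∉ 1F) (e≢ e∉ 3F)

        e≁s : ∀ {e} → e ∉ U → ¬ (e ~ s)
        e≁s e∉ es = noFour (symm ps) (symm qs) (symm rs) (symm es)
          p≢q (~⇒≢ pr) (e≢ e∉ 0F) (~⇒≢ qr) (e≢ e∉ 1F) (e≢ e∉ 2F)

        apart : ∀ {e a c} → e ∉ U → a ∈ U → c ∈ U → a ~ c → e ~ a → ¬ (e ~ c)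
        apart e∉ a∈ c∈ ac ea ec with to (im _) a∈ | to (im _) c∈
        ... | 0F , refl | 0F , refl = irrefl _ ac
        ... | 0F , refl | 1F , refl = p≁q ac
        ... | 1F , refl | 0F , refl = p≁q (symm ac)
        ... | 1F , refl | 1F , refl = irrefl _ ac
        ... | 2F , refl | _         = e≁r e∉ ea
        ... | 3F , refl | _         = e≁s e∉ ea
        ... | 0F , refl | 2F , refl = e≁r e∉ ec
        ... | 0F , refl | 3F , refl = e≁s e∉ ec
        ... | 1F , refl | 2F , refl = e≁r e∉ ec
        ... | 1F , refl | 3F , refl = e≁s e∉ ec

    module _ (connected : Connected G) (clawFree : ClawFree G) (≢K₄ : ¬ (K 4 ≅ G)) where
      private
        noK₄ : ∀ {a b c d} → a ~ b → a ~ c → a ~ d → b ~ c → b ~ d → ¬ (c ~ d)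
        noK₄ {a} {b} {c} {d} ab ac ad bc bd cd =
          ≢K₄ (emb , λ v → walk (proj₂ connected a v) (0F , refl))
          where
          f : Fin 4 → Fin n
          f = lookup (a ∷ b ∷ c ∷ d ∷ [])

          emb : K 4 ↪ G
          emb = embed₄ (K 4) f
            (good-edge (K 4) f (from-yes (1F ∈? nbhd (K 4) 0F)) ab)
            (good-edge (K 4) f (from-yes (2F ∈? nbhd (K 4) 0F)) ac)
            (good-edge (K 4) f (from-yes (3F ∈? nbhd (K 4) 0F)) ad)
            (good-edge (K 4) f (from-yes (2F ∈? nbhd (K 4) 1F)) bc)
            (good-edge (K 4) f (from-yes (3F ∈? nbhd (K 4) 1F)) bd)
            (good-edge (K 4) f (from-yes (3F ∈? nbhd (K 4) 2F)) cd)

          Hit : Fin n → Set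
          Hit v = ∃[ i ] f i ≡ v

          step : ∀ {v w} → v ~ w → Hit v → Hit w
          step {v} {w} vw hit with any? (λ i → f i ≟ w)
          ... | yes p = p
          ... | no  w∉ with hit
          ...   | 0F , refl = ⊥-elim (noFour ab ac ad vw (~⇒≢ bc) (~⇒≢ bd) (λ e → w∉ (1F , e)) (~⇒≢ cd) (λ e → w∉ (2F , e)) (λ e → w∉ (3F , e)))
          ...   | 1F , refl = ⊥-elim (noFour (symm ab) bc bd vw (~⇒≢ ac) (~⇒≢ ad) (λ e → w∉ (0F , e)) (~⇒≢ cd) (λ e → w∉ (2F , e)) (λ e → w∉ (3F , e)))
          ...   | 2F , refl = ⊥-elim (noFour (symm ac) (symm bc) cd vw (~⇒≢ ab) (~⇒≢ ad) (λ e → w∉ (0F , e)) (~⇒≢ bd) (λ e → w∉ (1F , e)) (λ e → w∉ (3F , e)))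
          ...   | 3F , refl = ⊥-elim (noFour (symm ad) (symm bd) (symm cd) vw (~⇒≢ ab) (~⇒≢ ac) (λ e → w∉ (0F , e)) (~⇒≢ bc) (λ e → w∉ (1F , e)) (λ e → w∉ (2F , e)))

          walk : ∀ {v w} → Star _~_ v w → Hit v → Hit w
          walk ε        h = h
          walk (e ◅ es) h = walk es (step e h)

        inTriangle : ∀ v → ∃[ x ] ∃[ y ] v ~ x × v ~ y × x ~ y
        inTriangle v with three (nbhd G v) (cubic v)
        ... | a , b , c , (va , vb , vc) , (a≢b , a≢c , b≢c) with a ~? b | a ~? c | b ~? c
        ...   | yes ab | _      | _      = a , b , va , vb , ab
        ...   | no _   | yes ac | _      = a , c , va , vc , ac
        ...   | no _   | no _   | yes bc = b , c , vb , vc , bc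
        ...   | no ab  | no ac  | no bc  = ⊥-elim (clawFree (embed₄ K₁,₃ f
                (good-edge K₁,₃ f (there here) va)
                (good-edge K₁,₃ f (there (there here)) vb)
                (good-edge K₁,₃ f (there (there (there here))) vc)
                (good-nonedge K₁,₃ f (λ { (there (there ())) }) a≢b ab)
                (good-nonedge K₁,₃ f (λ { (there (there (there ()))) }) a≢c ac)
                (good-nonedge K₁,₃ f (λ { (there (there (there ()))) }) b≢c bc)))
          where
          f : Fin 4 → Fin n
          f = lookup (v ∷ a ∷ b ∷ c ∷ [])

        closedUnit : ∀ v → ClosedUnitAt v
        closedUnit v with x , y , vx , vy , xy ← inTriangle v = found
          where
          f : Fin 3 → Fin n
          f = lookup (v ∷ x ∷ y ∷ [])

          U : Subset n
          U = image f

          im : ∀ w → w ∈ U ⇔ (∃[ i ] f i ≡ w)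
          im = ∈-image f

          unit : IsUnit G U
          unit = inj₁ (embed₃ (K 3) f
            (good-edge (K 3) f (from-yes (1F ∈? nbhd (K 3) 0F)) vx)
            (good-edge (K 3) f (from-yes (2F ∈? nbhd (K 3) 0F)) vy)
            (good-edge (K 3) f (from-yes (2F ∈? nbhd (K 3) 1F)) xy) , im)

          pick : ∀ {w} (xs : Vec (Fin n) 4) i → lookup xs i ≡ w →
                 ∃[ U ] (∀ i → lookup xs i ∈ U) × IsUnit G U × Closed U → ClosedUnitAt w
          pick _ i refl (U , ∈U , r) = U , ∈U i , r

          grow : ∀ e → e ∉ U → (∃[ i ] ∃[ j ] f i ~ f j × e ~ f i × e ~ f j) → ClosedUnitAt v
          grow e e∉ (i , j , ij , ei , ej) with e ~? v | e ~? x | e ~? y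
          ... | yes ev | yes ex | yes ey = ⊥-elim (noK₄ ev ex ey vx vy xy)
          ... | yes ev | yes ex | no  ey = pick (e ∷ y ∷ v ∷ x ∷ []) 2F refl (diamond (λ { refl → e∉ (from (im _) (2F , refl)) }) ey ev ex (symm vy) (symm xy) vx)
          ... | yes ev | no  ex | yes ey = pick (e ∷ x ∷ v ∷ y ∷ []) 2F refl (diamond (λ { refl → e∉ (from (im _) (1F , refl)) }) ex ev ey (symm vx) xy vy)
          ... | no  ev | yes ex | yes ey = pick (e ∷ v ∷ x ∷ y ∷ []) 1F refl (diamond (λ { refl → e∉ (from (im _) (0F , refl)) }) ev ex ey vx vy xy)
          ... | no  ev | no  ex | _      = ⊥-elim (few i j ij ei ej)
            where
            few : ∀ i j → f i ~ f j → e ~ f i → ¬ (e ~ f j)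
            few 0F _  _  ei _  = ev ei
            few 1F _  _  ei _  = ex ei
            few 2F 0F _  _  ej = ev ej
            few 2F 1F _  _  ej = ex ej
            few 2F 2F ij _  _  = irrefl _ ij
          ... | no  ev | yes _  | no  ey = ⊥-elim (few i j ij ei ej)
            where
            few : ∀ i j → f i ~ f j → e ~ f i → ¬ (e ~ f j)
            few 0F _  _  ei _  = ev ei
            few 2F _  _  ei _  = ey ei
            few 1F 0F _  _  ej = ev ej
            few 1F 2F _  _  ej = ey ej
            few 1F 1F ij _  _  = irrefl _ ij
          ... | yes _  | no  ex | no  ey = ⊥-elim (few i j ij ei ej)
            where
            few : ∀ i j → f i ~ f j → e ~ f i → ¬ (e ~ f j)
            few 1F _  _  ei _  = ex ei
            few 2F _  _  ei _  = ey ei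
            few 0F 1F _  _  ej = ex ej
            few 0F 2F _  _  ej = ey ej
            few 0F 0F ij _  _  = irrefl _ ij

          found : ClosedUnitAt v
          found with any? (λ e → ¬? (e ∈? U) ×-dec any? λ i → any? λ j → (f i ~? f j) ×-dec (e ~? f i) ×-dec (e ~? f j))
          ... | yes (e , e∉ , two) = grow e e∉ two
          ... | no  none = U , from (im v) (0F , refl) , unit , closed⁺ unit apart
            where
            apart : ∀ {e a c} → e ∉ U → a ∈ U → c ∈ U → a ~ c → e ~ a → ¬ (e ~ c)
            apart e∉ a∈ c∈ ac ea ec
              with i , refl ← to (im _) a∈ | j , refl ← to (im _) c∈
              = none (_ , e∉ , i , j , ac , ea , ec)

      unitPartition : UnitPartition G
      unitPartition = fromCover G (proj₁ ∘ closedUnit)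
        (λ v → proj₁ (proj₂ (closedUnit v)))
        (λ v → proj₁ (unit v))
        (λ v w x∈v x∈w → ⊆-antisym
          (unit⊆closed (proj₁ (unit v)) (proj₂ (unit w)) x∈v x∈w)
          (unit⊆closed (proj₁ (unit w)) (proj₂ (unit v)) x∈w x∈v))
        where
        unit : ∀ v → IsUnit G (proj₁ (closedUnit v)) × Closed (proj₁ (closedUnit v))
        unit v = proj₂ (proj₂ (closedUnit v))

-- By size-unique, every partition of G into units has this number of parts.
u : (G : Graph n) → Connected G → ClawFree G → Cubic G → ¬ (K 4 ≅ G) → ℕ
u G connected clawFree cubic ≢K₄ =
  UnitPartition.size (unitPartition G cubic connected clawFree ≢K₄)

{-# OPTIONS --safe #-}

-- Lower bound: every vertex has at least two neighbours in its own unit, hence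
-- at most one outside, so a unit without blue vertices can never be entered:
-- a spreading set meets every unit.  The first forcing vertex has at most one
-- white neighbour, hence a blue neighbour in its own unit, so some unit contains
-- two initially blue vertices.
--
-- Upper bound: three blue vertices forming a triangle turn their unit blue.  By
-- connectedness some edge b ~ w then leaves the blue units, w being the only
-- white neighbour of b; one blue neighbour x of w in its unit makes w, and then
-- the whole unit of w, blue.  So every unit after the first costs one vertex.

module Submission where

open import Data.Empty using (⊥-elim)
open import Data.Fin.Base using (Fin; zero; suc)
open import Data.Fin.Properties using (_≟_; any?; all?)
open import Data.Fin.Subset using (Subset; inside; outside; ⊤; ⁅_⁆; ∁; _∩_; _∪_; _-_; _∈_; _∉_; _⊆_; ∣_∣)
open import Data.Fin.Subset.Properties
open import Data.List.Base using ([]; _∷_; length)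
open import Data.List.Properties using (length-tabulate)
open import Data.List.Relation.Unary.All as All using (All; []; _∷_)
open import Data.List.Relation.Unary.All.Properties as Allₚ using ()
open import Data.List.Relation.Unary.AllPairs using ([]; _∷_)
open import Data.List.Relation.Unary.Unique.Propositional using (Unique)
open import Data.List.Relation.Unary.Unique.Propositional.Properties as Uniqueₚ using ()
open import Data.Nat using (ℕ; suc; _+_; _∸_; _≤_; _<_; z≤n; s≤s)
open import Data.Nat.Induction using (<-wellFounded)
open import Data.Nat.Properties using (≤-trans; ≤-reflexive; n≤1+n; n≮n; +-comm; +-monoˡ-≤; ∸-monoʳ-<; _≤?_; module ≤-Reasoning)
open import Data.Product using (Σ; ∃-syntax; _×_; _,_; proj₁; proj₂)
open import Data.Sum using (_⊎_; inj₁; inj₂)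
open import Data.Vec.Base using ([]; _∷_)
open import Function.Base using (_∘_)
open import Function.Bundles using (Equivalence)
open import Function.Definitions using (Injective)
open import Induction.WellFounded using (Acc; acc)
open import Relation.Binary.Construct.Closure.ReflexiveTransitive using (Star; ε; _◅_)
open import Relation.Binary.PropositionalEquality using (_≡_; _≢_; refl; sym; trans; cong; subst; ≢-sym)
open import Relation.Nullary using (¬_; Dec; yes; no)
open import Relation.Nullary.Construct.Add.Supremum using (_⁺; [_])
open import Relation.Nullary.Decidable using (_×-dec_; _⊎-dec_; ¬?; from-yes; map′)
import Relation.Binary.Construct.Add.Supremum.NonStrict _≤_ as Sup
open import Defs

open Equivalence using (to; from)

private variable
  m n : ℕ

-- Cardinalities of subsets

unique⇒length≤∣p∣ : ∀ {p : Subset n} {xs} → Unique xs → All (_∈ p) xs → length xs ≤ ∣ p ∣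
unique⇒length≤∣p∣ []       []         = z≤n
unique⇒length≤∣p∣ (x∉ ∷ u) (x∈ ∷ xs∈) = ≤-trans
  (s≤s (unique⇒length≤∣p∣ u
    (All.zipWith (λ (x≢y , y∈) → x∈p∧x≢y⇒x∈p-y y∈ (≢-sym x≢y)) (x∉ , xs∈))))
  (x∈p⇒∣p-x∣<∣p∣ x∈)

injective⇒≤∣p∣ : ∀ {p : Subset n} (f : Fin m → Fin n) → Injective _≡_ _≡_ f → (∀ i → f i ∈ p) → m ≤ ∣ p ∣
injective⇒≤∣p∣ f inj f∈ = subst (_≤ _) (length-tabulate f)
  (unique⇒length≤∣p∣ (Uniqueₚ.tabulate⁺ inj) (Allₚ.tabulate⁺ f∈))

∣p∪⁅x⁆∣≤1+∣p∣ : ∀ (p : Subset n) x → ∣ p ∪ ⁅ x ⁆ ∣ ≤ suc ∣ p ∣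
∣p∪⁅x⁆∣≤1+∣p∣ (inside  ∷ p) zero    = s≤s (≤-trans (≤-reflexive (cong ∣_∣ (∪-identityʳ p))) (n≤1+n _))
∣p∪⁅x⁆∣≤1+∣p∣ (outside ∷ p) zero    = s≤s (≤-reflexive (cong ∣_∣ (∪-identityʳ p)))
∣p∪⁅x⁆∣≤1+∣p∣ (inside  ∷ p) (suc x) = s≤s (∣p∪⁅x⁆∣≤1+∣p∣ p x)
∣p∪⁅x⁆∣≤1+∣p∣ (outside ∷ p) (suc x) = ∣p∪⁅x⁆∣≤1+∣p∣ p x

x∉p⇒∣p∣<∣p∪⁅x⁆∣ : ∀ {p : Subset n} {x} → x ∉ p → ∣ p ∣ < ∣ p ∪ ⁅ x ⁆ ∣
x∉p⇒∣p∣<∣p∪⁅x⁆∣ {p = p} {x} x∉ = p⊂q⇒∣p∣<∣q∣ (p⊆p∪q ⁅ x ⁆ , x , q⊆p∪q p _ (x∈⁅x⁆ x) , x∉)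

x∈p∪⁅x⁆ : ∀ (p : Subset n) x → x ∈ p ∪ ⁅ x ⁆
x∈p∪⁅x⁆ p x = q⊆p∪q p _ (x∈⁅x⁆ x)

-- Spreading and stable sets

module _ (p : ℕ) (q : ℕ ⁺) (G : Graph n) where
  -- A set at which spreading has stopped. Arguing about all stable supersets of a set avoids any
  -- bookkeeping of the order of recolorings.
  Stable : Subset n → Set
  Stable T = ∀ w → ¬ CanRecolor p q G T w

  private
    canRecolor? : ∀ S w → Dec (CanRecolor p q G S w)
    canRecolor? S w = map′ (λ (a , b , c) → canRecolor a b c)
      (λ (canRecolor a b c) → a , b , c)
      (¬? (w ∈? S) ×-dec (p ≤? _) ×-dec
        any? λ b → (b ∈? _) ×-dec Sup.≤⁺-dec _≤?_ _ q)

  -- Recolor while possible: the number of white vertices drops each time, every superset of the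
  -- enlarged set still contains `S`, and the final set is itself stable.
  stable⇒spreading : ∀ S → (∀ T → S ⊆ T → Stable T → ∀ v → v ∈ T) → IsSpreadingSet p q G S
  stable⇒spreading S full = go S full (<-wellFounded _)
    where
    go : ∀ S → (∀ T → S ⊆ T → Stable T → ∀ v → v ∈ T) → Acc _<_ (n ∸ ∣ S ∣) → IsSpreadingSet p q G S
    go S full (acc rec) with any? (canRecolor? S)
    ... | yes (w , r) = recolor r ◅ go (S ∪ ⁅ w ⁆) (λ T S⊆ → full T (S⊆ ∘ p⊆p∪q _))
          (rec (∸-monoʳ-< (x∉p⇒∣p∣<∣p∪⁅x⁆∣ (CanRecolor.white r)) (∣p∣≤n (S ∪ ⁅ w ⁆))))
    ... | no none = subst (λ X → Star (Recolors p q G) X ⊤)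
          (⊆-antisym (λ {v} _ → full S (λ x → x) (λ w r → none (w , r)) v) ⊆⊤) ε

-- The shape of a unit

-- {a, b, c} is a triangle, whose vertex a has degree 2 if H is a diamond.
Spans : Graph m → Fin m → Fin m → Fin m → Set
Spans H a b c = (a ~ b × a ~ c × b ~ c) × ∀ v → v ≡ a ⊎ v ≡ b ⊎ v ≡ c ⊎ (v ≢ a × b ~ v × c ~ v)
  where open Graph H

TwoNbrs ThreeNbrs : Graph m → Fin m → Set
TwoNbrs   H v = ∃[ a ] ∃[ b ] a ≢ b × Graph._~_ H v a × Graph._~_ H v b
ThreeNbrs H v = ∃[ a ] ∃[ b ] ∃[ c ] (a ≢ b × a ≢ c × b ≢ c) ×
  (Graph._~_ H v a × Graph._~_ H v b × Graph._~_ H v c)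

SpannedFrom : Graph m → Fin m → Set
SpannedFrom H a = ∃[ b ] ∃[ c ] Spans H a b c

-- The facts about `K 3` and `K₄-e` used below, in decidable form, so that evaluation settles both
-- graphs. In the last clause `ThreeNbrs` covers the two vertices of degree 3 in a diamond.
UnitShape : Graph m → Set
UnitShape H = (∀ v → TwoNbrs H v) × (∃[ v ] SpannedFrom H v) × (∀ v → SpannedFrom H v ⊎ ThreeNbrs H v)

unitShape? : (H : Graph m) → Dec (UnitShape H)
unitShape? H = (all? twoNbrs?) ×-dec (any? spannedFrom?) ×-dec (all? λ v → spannedFrom? v ⊎-dec threeNbrs? v)
  where
  open Graph H
  twoNbrs? : ∀ v → Dec (TwoNbrs H v)
  twoNbrs? v = any? λ a → any? λ b → ¬? (a ≟ b) ×-dec (v ~? a) ×-dec (v ~? b)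

  threeNbrs? : ∀ v → Dec (ThreeNbrs H v)
  threeNbrs? v = any? λ a → any? λ b → any? λ c →
    (¬? (a ≟ b) ×-dec ¬? (a ≟ c) ×-dec ¬? (b ≟ c)) ×-dec ((v ~? a) ×-dec (v ~? b) ×-dec (v ~? c))

  spannedFrom? : ∀ v → Dec (SpannedFrom H v)
  spannedFrom? a = any? λ b → any? λ c → ((a ~? b) ×-dec (a ~? c) ×-dec (b ~? c)) ×-dec
    (all? λ v → (v ≟ a) ⊎-dec (v ≟ b) ⊎-dec (v ≟ c) ⊎-dec (¬? (v ≟ a) ×-dec (b ~? v) ×-dec (c ~? v)))

unitShape : ∀ {G : Graph n} {U} → IsUnit G U → ∃[ m ] Σ (Graph m) λ H → UnitShape H × Induces G U H
unitShape (inj₁ t) = 3 , K 3 , from-yes (unitShape? (K 3)) , t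
unitShape (inj₂ d) = 4 , K₄-e , from-yes (unitShape? K₄-e) , d

-- Units and forcing in a cubic graph

module CubicGraph (G : Graph n) (cubic : Cubic G) where
  open Graph G

  ~⇒≢ : ∀ {v w} → v ~ w → v ≢ w
  ~⇒≢ {v} p refl = irrefl v p

  ∈∉⇒≢ : ∀ {U : Subset n} {x y} → x ∈ U → y ∉ U → x ≢ y
  ∈∉⇒≢ x∈ y∉ refl = y∉ x∈

  nbr-cases : ∀ {v a b c d} → v ~ a → v ~ b → v ~ c → a ≢ b → a ≢ c → b ≢ c →
              v ~ d → d ≡ a ⊎ d ≡ b ⊎ d ≡ c
  nbr-cases {v} {a} {b} {c} {d} va vb vc ab ac bc vd with d ≟ a | d ≟ b | d ≟ c
  ... | yes e | _     | _     = inj₁ e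
  ... | no _  | yes e | _     = inj₂ (inj₁ e)
  ... | no _  | no _  | yes e = inj₂ (inj₂ e)
  ... | no da | no db | no dc = ⊥-elim (n≮n 3 (subst (4 ≤_) (cubic v) (unique⇒length≤∣p∣
    ((da ∷ db ∷ dc ∷ []) ∷ (ab ∷ ac ∷ []) ∷ (bc ∷ []) ∷ [] ∷ [])
    (vd ∷ va ∷ vb ∷ vc ∷ []))))

  -- `Spans` carried into `G`, so that later arguments treat triangles and diamonds alike.
  SpansUnit : Subset n → Fin n → Fin n → Fin n → Set
  SpansUnit U a b c = (b ∈ U × c ∈ U) × (a ~ b × a ~ c × b ~ c) ×
    (∀ {v} → v ∈ U → v ≡ a ⊎ v ≡ b ⊎ v ≡ c ⊎ (v ≢ a × b ~ v × c ~ v))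

  spans⇒spansUnit : ∀ {H : Graph m} {U a b c} ((f , _) : Induces G U H) →
    Spans H a b c → SpansUnit U (_↪_.map f a) (_↪_.map f b) (_↪_.map f c)
  spans⇒spansUnit {H = H} {U} {a} {b} {c} (f , im) ((ab , ac , bc) , rest) =
    (from (im _) (b , refl) , from (im _) (c , refl)) , (adj ab , adj ac , adj bc) , rest′
    where
    adj : ∀ {i j} → Graph._~_ H i j → _↪_.map f i ~ _↪_.map f j
    adj = to (_↪_.adjacency f _ _)
    rest′ : ∀ {v} → v ∈ U → _
    rest′ {v} v∈ with i , refl ← to (im v) v∈ with rest i
    ... | inj₁ e = inj₁ (cong (_↪_.map f) e)
    ... | inj₂ (inj₁ e) = inj₂ (inj₁ (cong (_↪_.map f) e))
    ... | inj₂ (inj₂ (inj₁ e)) = inj₂ (inj₂ (inj₁ (cong (_↪_.map f) e)))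
    ... | inj₂ (inj₂ (inj₂ (v≢ , bv , cv))) = inj₂ (inj₂ (inj₂ (v≢ ∘ _↪_.injective f , adj bv , adj cv)))

  spanned : ∀ {U} → IsUnit G U → ∃[ a ] ∃[ b ] ∃[ c ] SpansUnit U a b c
  spanned unit with m , H , (_ , (a , b , c , s) , _) , ind ← unitShape unit =
    _ , _ , _ , spans⇒spansUnit ind s

  twoNbrsInUnit : ∀ {U v} → IsUnit G U → v ∈ U → ∃[ x ] ∃[ y ] x ≢ y × (x ∈ U × y ∈ U) × v ~ x × v ~ y
  twoNbrsInUnit {v = v} unit v∈
    with m , H , (two , _) , f , im ← unitShape unit
    with i , refl ← to (im v) v∈
    with j , k , j≢k , ij , ik ← two i
    = _ , _ , j≢k ∘ _↪_.injective f , (from (im _) (j , refl) , from (im _) (k , refl))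
    , to (_↪_.adjacency f _ _) ij , to (_↪_.adjacency f _ _) ik

  -- A vertex with a neighbor outside its unit cannot have all three neighbors inside, which leaves
  -- the first alternative of the shape.
  spannedFromBoundary : ∀ {U w b} → IsUnit G U → w ∈ U → b ∉ U → b ~ w → ∃[ x ] ∃[ y ] SpansUnit U w x y
  spannedFromBoundary {w = w} unit w∈ b∉ bw
    with m , H , (_ , _ , shape) , f , im ← unitShape unit
    with i , refl ← to (im w) w∈
    with shape i
  ... | inj₁ (j , k , s) = _ , _ , spans⇒spansUnit (f , im) s
  ... | inj₂ (j , k , l , (jk , jl , kl) , ij , ik , il)
    with nbr-cases (adj ij) (adj ik) (adj il) (jk ∘ inj) (jl ∘ inj) (kl ∘ inj) (symm bw)
    where
    adj : ∀ {i j} → Graph._~_ H i j → _↪_.map f i ~ _↪_.map f j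
    adj = to (_↪_.adjacency f _ _)
    inj = _↪_.injective f
  ...   | inj₁ refl = ⊥-elim (b∉ (from (im _) (j , refl)))
  ...   | inj₂ (inj₁ refl) = ⊥-elim (b∉ (from (im _) (k , refl)))
  ...   | inj₂ (inj₂ refl) = ⊥-elim (b∉ (from (im _) (l , refl)))

  -- The color change rule read in a stable set: `a` and `b` are the two blue neighbors, and `b` is
  -- the forcer because only `w` could be white next to it.
  force : ∀ {T w a b} → Stable 2 [ 1 ] G T → a ≢ b → w ~ a → w ~ b → a ∈ T → b ∈ T →
          (∀ {c} → b ~ c → c ≢ w → c ∈ T) → w ∈ T
  force {T} {w} {a} {b} stable a≢b wa wb a∈ b∈ rest with w ∈? T
  ... | yes w∈ = w∈
  ... | no  w∉ = ⊥-elim (stable w (canRecolor w∉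
    (unique⇒length≤∣p∣ ((a≢b ∷ []) ∷ [] ∷ []) (x∈p∩q⁺ (wa , a∈) ∷ x∈p∩q⁺ (wb , b∈) ∷ []))
    (b , x∈p∩q⁺ (wb , b∈) , Sup.[ subst (∣ nbhd b ∩ ∁ T ∣ ≤_) (∣⁅x⁆∣≡1 w) (p⊆q⇒∣p∣≤∣q∣ onlyW) ])))
    where
    onlyW : nbhd b ∩ ∁ T ⊆ ⁅ w ⁆
    onlyW {c} c∈ with x∈p∩q⁻ (nbhd b) (∁ T) c∈ | c ≟ w
    ... | _       | yes refl = x∈⁅x⁆ w
    ... | bc , c∉ | no c≢w   = ⊥-elim (x∈∁p⇒x∉p c∉ (rest bc c≢w))

  -- Only the fourth vertex `v` of a diamond remains. The neighbors of `b` are `a`, `c` and `v`, so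
  -- `b` forces `v`, with `c` as second blue neighbor.
  triangle-forces-unit : ∀ {U T a b c} → Stable 2 [ 1 ] G T → SpansUnit U a b c →
                         a ∈ T → b ∈ T → c ∈ T → U ⊆ T
  triangle-forces-unit {T = T} stable (_ , (ab , ac , bc) , cover) a∈ b∈ c∈ {v} v∈ with cover v∈
  ... | inj₁ refl = a∈
  ... | inj₂ (inj₁ refl) = b∈
  ... | inj₂ (inj₂ (inj₁ refl)) = c∈
  ... | inj₂ (inj₂ (inj₂ (v≢a , bv , cv))) =
    force stable (≢-sym (~⇒≢ bc)) (symm cv) (symm bv) c∈ b∈ others
    where
    others : ∀ {d} → _ ~ d → d ≢ v → d ∈ T
    others bd d≢v with nbr-cases (symm ab) bc bv (~⇒≢ ac) (≢-sym v≢a) (~⇒≢ cv) bd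
    ... | inj₁ refl = a∈
    ... | inj₂ (inj₁ refl) = c∈
    ... | inj₂ (inj₂ refl) = ⊥-elim (d≢v refl)

  -- First `b` forces `w`, then `w`, whose neighbors are `x`, `y` and `b`, forces `y`; both times
  -- `x` is the second blue neighbor.
  edge-forces-unit : ∀ {U T w x y b} → Stable 2 [ 1 ] G T → SpansUnit U w x y → b ∉ U → b ~ w →
    b ∈ T → (∀ {c} → b ~ c → c ≢ w → c ∈ T) → x ∈ T → U ⊆ T
  edge-forces-unit {T = T} {w} {x} {y} stable s@((x∈ , y∈) , (wx , wy , xy) , _) b∉ bw b∈T rest x∈T =
    triangle-forces-unit stable s w∈T x∈T y∈T
    where
    w∈T : w ∈ T
    w∈T = force stable (∈∉⇒≢ x∈ b∉) wx (symm bw) x∈T b∈T rest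

    others : ∀ {d} → w ~ d → d ≢ y → d ∈ T
    others wd d≢y with nbr-cases wx wy (symm bw) (~⇒≢ xy) (∈∉⇒≢ x∈ b∉) (∈∉⇒≢ y∈ b∉) wd
    ... | inj₁ refl = x∈T
    ... | inj₂ (inj₁ refl) = ⊥-elim (d≢y refl)
    ... | inj₂ (inj₂ refl) = b∈T

    y∈T : y ∈ T
    y∈T = force stable (≢-sym (~⇒≢ wx)) (symm xy) (symm wy) x∈T w∈T others

  module _ (P : UnitPartition G) where
    open UnitPartition P

    ∈-parts⇒≡ : ∀ {v i j} → v ∈ part i → v ∈ part j → i ≡ j
    ∈-parts⇒≡ {v} v∈i v∈j with k , _ , uniq ← partition v = trans (sym (uniq v∈i)) (uniq v∈j)

    -- Lower bound

    -- Avoiding a unit is preserved by recoloring: a vertex of the unit has two white neighbors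
    -- there, so two blue ones would give it degree at least 4. The final set `⊤` avoids no unit.
    spreading-meets-units : ∀ {S} → IsSpreadingSet 2 [ 1 ] G S → ∀ i → ∃[ v ] v ∈ S × v ∈ part i
    spreading-meets-units {S} spreading i with any? (λ v → (v ∈? S) ×-dec (v ∈? part i))
    ... | yes p = p
    ... | no  p = ⊥-elim (never spreading λ v∈S v∈U → p (_ , v∈S , v∈U))
      where
      never : ∀ {S} → IsSpreadingSet 2 [ 1 ] G S → ¬ (∀ {v} → v ∈ S → v ∉ part i)
      never ε avoids with a , b , c , (b∈ , _) , _ ← spanned (isUnit i) = avoids ∈⊤ b∈
      never {S} (recolor {w} (canRecolor _ blue _) ◅ rs) avoids = never rs avoids′
        where
        -- The neighbors `x` and `y` in the unit are white, so deleting them from the neighborhood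
        -- loses no blue neighbor.
        outsideNbrs : ∀ {x y} → x ∈ part i → y ∈ part i → nbhd w ∩ S ⊆ nbhd w - x - y
        outsideNbrs x∈ y∈ z∈ with wz , z∈S ← x∈p∩q⁻ (nbhd w) S z∈ = x∈p∧x≢y⇒x∈p-y
          (x∈p∧x≢y⇒x∈p-y wz (≢-sym (∈∉⇒≢ x∈ (avoids z∈S)))) (≢-sym (∈∉⇒≢ y∈ (avoids z∈S)))

        w∉ : w ∉ part i
        w∉ w∈ with x , y , x≢y , (x∈ , y∈) , wx , wy ← twoNbrsInUnit (isUnit i) w∈ =
          n≮n 3 (begin
            4                            ≤⟨ s≤s (s≤s blue) ⟩
            2 + ∣ nbhd w ∩ S ∣           ≤⟨ s≤s (s≤s (p⊆q⇒∣p∣≤∣q∣ (outsideNbrs x∈ y∈))) ⟩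
            2 + ∣ nbhd w - x - y ∣       ≤⟨ s≤s (x∈p⇒∣p-x∣<∣p∣ (x∈p∧x≢y⇒x∈p-y wy (≢-sym x≢y))) ⟩
            1 + ∣ nbhd w - x ∣           ≤⟨ x∈p⇒∣p-x∣<∣p∣ wx ⟩
            ∣ nbhd w ∣                   ≡⟨ cubic w ⟩
            3                            ∎)
          where open ≤-Reasoning

        avoids′ : ∀ {v} → v ∈ S ∪ ⁅ w ⁆ → v ∉ part i
        avoids′ v∈ with x∈p∪q⁻ S ⁅ w ⁆ v∈
        ... | inj₁ v∈S = avoids v∈S
        ... | inj₂ v∈w with refl ← x∈⁅y⁆⇒x≡y w v∈w = w∉

    spreading-has-blue-pair : ∀ {S} → Fin n → IsSpreadingSet 2 [ 1 ] G S →
      ∃[ i ] ∃[ b ] ∃[ x ] b ≢ x × (b ∈ S × b ∈ part i) × (x ∈ S × x ∈ part i)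
    -- Without any recoloring all vertices are blue, so `v` and a neighbor in its unit serve.
    spreading-has-blue-pair v ε
      with i , v∈ , _ ← partition v
      with x , _ , _ , (x∈ , _) , vx , _ ← twoNbrsInUnit (isUnit i) v∈
      = i , v , x , ~⇒≢ vx , (∈⊤ , v∈) , (∈⊤ , x∈)
    spreading-has-blue-pair {S} _ (recolor {w} (canRecolor _ _ (b , b∈ , Sup.[ few ])) ◅ _)
      with i , b∈i , _ ← partition b
      with x , y , x≢y , (x∈ , y∈) , bx , by ← twoNbrsInUnit (isUnit i) b∈i
      with x ∈? S | y ∈? S
    ... | yes x∈S | _       = i , b , x , ~⇒≢ bx , (proj₂ (x∈p∩q⁻ (nbhd w) S b∈) , b∈i) , (x∈S , x∈)
    ... | no  _   | yes y∈S = i , b , y , ~⇒≢ by , (proj₂ (x∈p∩q⁻ (nbhd w) S b∈) , b∈i) , (y∈S , y∈)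
    ... | no  x∉S | no  y∉S = ⊥-elim (n≮n 1 (≤-trans
      (unique⇒length≤∣p∣ ((x≢y ∷ []) ∷ [] ∷ [])
        (x∈p∩q⁺ (bx , x∉p⇒x∈∁p x∉S) ∷ x∈p∩q⁺ (by , x∉p⇒x∈∁p y∉S) ∷ []))
      few))

    size<∣spreading∣ : ∀ {S} → Fin n → IsSpreadingSet 2 [ 1 ] G S → size < ∣ S ∣
    size<∣spreading∣ {S} v₀ spreading = injective⇒≤∣p∣ f f-injective f∈
      where
      rep : ∀ i → ∃[ v ] v ∈ S × v ∈ part i
      rep = spreading-meets-units spreading

      -- At most one vertex of the blue pair is the representative of their unit; the other is the
      -- additional vertex.
      extra : ∃[ i ] ∃[ e ] e ≢ proj₁ (rep i) × e ∈ S × e ∈ part i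
      extra with i , b , x , b≢x , (b∈S , b∈) , (x∈S , x∈) ← spreading-has-blue-pair v₀ spreading
        with b ≟ proj₁ (rep i)
      ... | no  b≢  = i , b , b≢ , b∈S , b∈
      ... | yes b≡  = i , x , (λ x≡ → b≢x (trans b≡ (sym x≡))) , x∈S , x∈

      f : Fin (suc size) → Fin n
      f zero    = proj₁ (proj₂ extra)
      f (suc i) = proj₁ (rep i)

      extra≢rep : ∀ i → f zero ≢ f (suc i)
      extra≢rep i eq with j , e , e≢ , _ , e∈ ← extra | v , _ , v∈ ← rep i in r
        with refl ← eq with refl ← ∈-parts⇒≡ e∈ v∈ = e≢ (sym (cong proj₁ r))

      f-injective : Injective _≡_ _≡_ f
      f-injective {zero}  {zero}  eq = refl
      f-injective {zero}  {suc j} eq = ⊥-elim (extra≢rep j eq)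
      f-injective {suc i} {zero}  eq = ⊥-elim (extra≢rep i (sym eq))
      f-injective {suc i} {suc j} eq = cong suc (∈-parts⇒≡ (proj₂ (proj₂ (rep i)))
        (subst (_∈ part j) (sym eq) (proj₂ (proj₂ (rep j)))))

      f∈ : ∀ i → f i ∈ S
      f∈ zero    = proj₁ (proj₂ (proj₂ (proj₂ extra)))
      f∈ (suc i) = proj₁ (proj₂ (rep i))

    -- Upper bound

    -- Stated over all stable supersets of `S`, hence kept when `S` grows. The forced units form a
    -- `Subset size` so that they can be counted.
    Forces : Subset n → Subset size → Set
    Forces S D = ∀ {T} → S ⊆ T → Stable 2 [ 1 ] G T → ∀ {i} → i ∈ D → part i ⊆ T

    Covered : Subset size → Fin n → Set
    Covered D v = ∃[ i ] i ∈ D × v ∈ part i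

    covered? : ∀ D v → Dec (Covered D v)
    covered? D v = any? λ i → (i ∈? D) ×-dec (v ∈? part i)

    crossingEdge : ∀ D {v w} → Star _~_ v w → Covered D v → ¬ Covered D w →
                   ∃[ b ] ∃[ c ] b ~ c × Covered D b × ¬ Covered D c
    crossingEdge D ε v∈ w∉ = ⊥-elim (w∉ v∈)
    crossingEdge D (_◅_ {j = x} e es) v∈ w∉ with covered? D x
    ... | yes x∈ = crossingEdge D es x∈ w∉
    ... | no  x∉ = _ , x , e , v∈ , x∉

    seed : ∀ i → ∃[ S ] ∣ S ∣ ≤ 3 × Forces S ⁅ i ⁆
    seed i with a , b , c , s ← spanned (isUnit i) = S , ∣S∣≤3 , forces
      where
      S : Subset n
      S = (⁅ a ⁆ ∪ ⁅ b ⁆) ∪ ⁅ c ⁆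

      ∣S∣≤3 : ∣ S ∣ ≤ 3
      ∣S∣≤3 = ≤-trans (∣p∪⁅x⁆∣≤1+∣p∣ (⁅ a ⁆ ∪ ⁅ b ⁆) c) (s≤s (≤-trans (∣p∪⁅x⁆∣≤1+∣p∣ ⁅ a ⁆ b)
        (s≤s (≤-reflexive (∣⁅x⁆∣≡1 a)))))

      forces : Forces S ⁅ i ⁆
      forces S⊆T stable j∈ with refl ← x∈⁅y⁆⇒x≡y i j∈ = triangle-forces-unit stable s
        (S⊆T (p⊆p∪q _ (p⊆p∪q _ (x∈⁅x⁆ a)))) (S⊆T (p⊆p∪q _ (x∈p∪⁅x⁆ _ b))) (S⊆T (x∈p∪⁅x⁆ _ c))

    -- One vertex `x` pays for one new unit `j`: the unit of `b` is already blue, so `w` is the only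
    -- neighbor of `b` that may be white.
    extend : ∀ {S D b w} → Forces S D → b ~ w → Covered D b → ¬ Covered D w →
             ∃[ x ] ∃[ j ] j ∉ D × Forces (S ∪ ⁅ x ⁆) (D ∪ ⁅ j ⁆)
    extend {S} {D} {b} {w} forces bw (i , i∈ , b∈) w∉ =
      let j , w∈ , _ = partition w
          x , y , s  = spannedFromBoundary (isUnit j) w∈ (b∉ w∈) bw
      in x , j , (λ j∈ → w∉ (j , j∈ , w∈)) , forces′ (b∉ w∈) s
      where
      b∉ : ∀ {j} → w ∈ part j → b ∉ part j
      b∉ w∈ b∈j with refl ← ∈-parts⇒≡ b∈ b∈j = w∉ (i , i∈ , w∈)

      -- The two neighbors of `b` in its unit, together with `w`, are all its neighbors.
      rest : ∀ {c} → b ~ c → c ≢ w → c ∈ part i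
      rest bc c≢w
        with x , y , x≢y , (x∈ , y∈) , bx , by ← twoNbrsInUnit (isUnit i) b∈
        with nbr-cases bx by bw x≢y (∈∉⇒≢ x∈ (λ w∈ → b∉ w∈ b∈)) (∈∉⇒≢ y∈ (λ w∈ → b∉ w∈ b∈)) bc
      ... | inj₁ refl = x∈
      ... | inj₂ (inj₁ refl) = y∈
      ... | inj₂ (inj₂ refl) = ⊥-elim (c≢w refl)

      forces′ : ∀ {j x y} → b ∉ part j → SpansUnit (part j) w x y → Forces (S ∪ ⁅ x ⁆) (D ∪ ⁅ j ⁆)
      forces′ {j} {x} b∉j s {T} S⊆T stable k∈ with x∈p∪q⁻ D ⁅ j ⁆ k∈
      ... | inj₁ k∈D = forces (S⊆T ∘ p⊆p∪q _) stable k∈D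
      ... | inj₂ k∈j with refl ← x∈⁅y⁆⇒x≡y j k∈j = edge-forces-unit stable s b∉j bw
        (blue b∈) (λ bc c≢w → blue (rest bc c≢w)) (S⊆T (x∈p∪⁅x⁆ S x))
        where
        blue : part i ⊆ T
        blue = forces (S⊆T ∘ p⊆p∪q _) stable i∈

    -- The invariant is `∣ S ∣ ≤ ∣ D ∣ + 2`, with `D` a set of forced units. The seed meets it with
    -- three vertices for one unit, and `∣ D ∣` never exceeds `size`.
    spreadingSet : Connected G → ∃[ S ] IsSpreadingSet 2 [ 1 ] G S × ∣ S ∣ ≤ size + 2
    spreadingSet (v₀ , walk)
      with i₀ , v₀∈ , _ ← partition v₀
      with S₀ , ∣S₀∣≤3 , forces₀ ← seed i₀
      = go S₀ ⁅ i₀ ⁆ (i₀ , x∈⁅x⁆ i₀ , v₀∈)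
          (subst (λ k → ∣ S₀ ∣ ≤ k + 2) (sym (∣⁅x⁆∣≡1 i₀)) ∣S₀∣≤3) forces₀ (<-wellFounded _)
      where
      go : ∀ S D → Covered D v₀ → ∣ S ∣ ≤ ∣ D ∣ + 2 → Forces S D → Acc _<_ (size ∸ ∣ D ∣) →
           ∃[ S ] IsSpreadingSet 2 [ 1 ] G S × ∣ S ∣ ≤ size + 2
      go S D v₀∈ ∣S∣≤ forces (acc rec) with any? (λ w → ¬? (covered? D w))
      ... | no none = S , stable⇒spreading 2 [ 1 ] G S full , ≤-trans ∣S∣≤ (+-monoˡ-≤ 2 (∣p∣≤n D))
        where
        full : ∀ T → S ⊆ T → Stable 2 [ 1 ] G T → ∀ v → v ∈ T
        full T S⊆T stable v with covered? D v
        ... | yes (i , i∈ , v∈) = forces S⊆T stable i∈ v∈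
        ... | no  v∉            = ⊥-elim (none (v , v∉))
      ... | yes (w , w∉)
        with b , c , bc , b∈ , c∉ ← crossingEdge D (walk v₀ w) v₀∈ w∉
        with x , j , j∉ , forces′ ← extend forces bc b∈ c∉
        with i , i∈ , v₀∈i ← v₀∈
        = go (S ∪ ⁅ x ⁆) (D ∪ ⁅ j ⁆) (i , p⊆p∪q _ i∈ , v₀∈i)
            -- The vertex `x` may already lie in `S`, so `∣ S ∣` grows by at most one, whereas `j`
            -- is new and `∣ D ∣` strictly grows.
            (≤-trans (∣p∪⁅x⁆∣≤1+∣p∣ S x) (≤-trans (s≤s ∣S∣≤) (+-monoˡ-≤ 2 (x∉p⇒∣p∣<∣p∪⁅x⁆∣ j∉))))
            forces′
            (rec (∸-monoʳ-< (x∉p⇒∣p∣<∣p∪⁅x⁆∣ j∉) (∣p∣≤n (D ∪ ⁅ j ⁆))))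

theorem4p9 : ∀ {n : ℕ} (G : Graph n) (connected : Connected G) (clawFree : ClawFree G) (cubic : Cubic G) (≢K₄ : ¬ (K 4 ≅ G)) →
    (u G connected clawFree cubic ≢K₄ + 1 ≤ σ 2 [ 1 ] G) × (σ 2 [ 1 ] G ≤ u G connected clawFree cubic ≢K₄ + 2)
theorem4p9 G connected clawFree cubic ≢K₄ =
  -- The lower bound is applied to the minimum set `M` that defines `σ`; the upper bound compares
  -- `M` with the constructed `S`.
  let S , spreading , ∣S∣≤ = spreadingSet P connected
      M , spreadingM , minimal = minimumSpreadingSet 2 [ 1 ] G
  in subst (_≤ ∣ M ∣) (+-comm 1 (UnitPartition.size P)) (size<∣spreading∣ P (proj₁ connected) spreadingM)
   , ≤-trans (minimal S spreading) ∣S∣≤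
  where
  open CubicGraph G cubic
  P = unitPartition G cubic connected clawFree ≢K₄
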